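{- Let $\mathcal C$ be a class of ordered graphs of bounded degree (there is $d$ with $\Delta(G)\le d$ for all $(G,\prec)\in\mathcal C$). Then $\mathcal C$ has bounded stretch-width (there is $k$ with $\mathrm{stw}(G,\prec)\le k$ for all $(G,\prec)\in\mathcal C$) if and only if there is an integer $t$ such that no graph in $\{\mathrm{Ov}(G,\prec) : (G,\prec)\in\mathcal C\}$ has a $K_{t,t}$ subgraph.
   Context: An ordered graph $(G,\prec)$ is a finite simple graph with a strict total order $\prec$ on $V(G)$. For an edge $e$, $L(e)$ and $R(e)$ denote its $\prec$-smaller and $\prec$-larger endpoint. Edges $e,f$ cross if $L(e)\prec L(f)\prec R(e)\prec R(f)$ or $L(f)\prec L(e)\prec R(f)\prec R(e)$. The overlap graph $\mathrm{Ov}(G,\prec)$ has vertex set $E(G)$ and an edge between any two crossing edges. Subgraphs need not be induced. A partition sequence of an $n$-vertex graph $G$ is a sequence $\mathcal P_n,\dots,\mathcal P_1$ of partitions of $V(G)$ with $\mathcal P_n$ the singleton partition, $\mathcal P_1=\{V(G)\}$, each obtained from the previous by merging two parts. Distinct parts $X,Y$ are inhomogeneous if there are $u,u'\in X$, $v,v'\in Y$ with $uv\in E(G)$, $u'v'\notin E(G)$; the red graph $\mathcal R(\mathcal P)$ has vertex set $\mathcal P$ and edges between inhomogeneous parts. The span of $X\subseteq V(G)$ is $\langle X\rangle=\{v:\min X\preceq v\preceq\max X\}$; $X,Y$ conflict if their spans intersect. For $X\in\mathcal P$, $Y\in\mathcal P\setminus\{X\}$ interferes with $X$ if $Y$ conflicts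 with the union of the parts in the closed neighborhood of $X$ in $\mathcal R(\mathcal P)$; the stretch of $X$ is the number of parts interfering with it; the stretch of $\mathcal P$ is the maximum over parts. $\mathrm{stw}(G,\prec)$ is the minimum over partition sequences of the maximum stretch of its partitions. -}

module Defs where

open import Data.Nat as ℕ using (ℕ; suc; _∸_)
open import Data.Fin using (Fin) renaming (_<_ to _<ᶠ_; _≤_ to _≤ᶠ_)
open import Data.Bool using (Bool; true; false; _∨_; _∧_)
open import Data.List using (List; length)
open import Data.List.Relation.Unary.All using (All)
open import Data.List.Relation.Unary.AllPairs using (AllPairs)
open import Data.Product using (Σ; ∃; ∃-syntax; _×_; _,_; proj₁; proj₂)
open import Data.Sum using (_⊎_)
open import Relation.Nullary using (¬_)
open import Relation.Binary.PropositionalEquality using (_≡_; _≢_)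

-- Ordered graphs: vertex set Fin n, ordered by the natural order of Fin.
-- Finite simple graph: symmetric, irreflexive (decidable) adjacency.

record Graph (n : ℕ) : Set where
  field
    adj    : Fin n → Fin n → Bool
    adj-sym : ∀ u v → adj u v ≡ adj v u
    adj-irr : ∀ v → adj v v ≡ false
open Graph public

Adj : ∀ {n} → Graph n → Fin n → Fin n → Set
Adj G u v = adj G u v ≡ true

-- "the number of elements a (counted up to the 'distinct' relation D)
--  satisfying P is at most k": every list of pairwise D-distinct
--  elements satisfying P has length at most k.
AtMost : {A : Set} → (A → A → Set) → (A → Set) → ℕ → Set
AtMost {A} D P k = (xs : List A) → All P xs → AllPairs D xs → length xs ℕ.≤ k

MaxDegreeAtMost : ∀ {n} → Graph n → ℕ → Set
MaxDegreeAtMost {n} G d = (v : Fin n) → AtMost _≢_ (Adj G v) d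

-- Partitions of V(G), given as (Boolean) equivalence relations
-- "u and v lie in the same part".  A part is the class of a vertex.

Part : ℕ → Set
Part n = Fin n → Fin n → Bool

Same : ∀ {n} → Part n → Fin n → Fin n → Set
Same P u v = P u v ≡ true

Diff : ∀ {n} → Part n → Fin n → Fin n → Set
Diff P u v = P u v ≡ false

Discrete : ∀ {n} → Part n → Set
Discrete {n} P = ((u : Fin n) → Same P u u) × ((u v : Fin n) → Same P u v → u ≡ v)

Whole : ∀ {n} → Part n → Set
Whole {n} P = (u v : Fin n) → Same P u v

MergeOf : ∀ {n} → Part n → Part n → Set
MergeOf {n} P Q = ∃[ x ] ∃[ y ] (Diff P x y ×
  ((u v : Fin n) → Q u v ≡ (P u v ∨ ((P u x ∧ P v y) ∨ (P u y ∧ P v x)))))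

-- Partition sequence P_n, …, P_1 : seq i is P_{n-i} (i merges done),
-- for i = 0 … n-1.
record PartitionSequence (n : ℕ) : Set where
  field
    seq     : ℕ → Part n
    start   : Discrete (seq 0)
    finish  : Whole (seq (n ∸ 1))
    merges  : (i : ℕ) → suc i ℕ.≤ n ∸ 1 → MergeOf (seq i) (seq (suc i))
open PartitionSequence public

Inhomogeneous : ∀ {n} → Graph n → Part n → Fin n → Fin n → Set
Inhomogeneous G P x y = Diff P x y ×
  ∃[ u ] ∃[ u' ] ∃[ v ] ∃[ v' ]
    (Same P x u × Same P x u' × Same P y v × Same P y v' ×
     Adj G u v × adj G u' v' ≡ false)

-- w belongs to the union of the parts in the closed red neighbourhood
-- of the part of x
InClosedRedNbhd : ∀ {n} → Graph n → Part n → Fin n → Fin n → Set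
InClosedRedNbhd G P x w = Same P x w ⊎ Inhomogeneous G P x w

InSpan : ∀ {n} → (Fin n → Set) → Fin n → Set
InSpan S w = ∃[ a ] ∃[ b ] (S a × S b × a ≤ᶠ w × w ≤ᶠ b)

Conflict : ∀ {n} → (Fin n → Set) → (Fin n → Set) → Set
Conflict S T = ∃[ w ] (InSpan S w × InSpan T w)

Interferes : ∀ {n} → Graph n → Part n → Fin n → Fin n → Set
Interferes G P x y = Diff P x y × Conflict (Same P y) (InClosedRedNbhd G P x)

-- stretch of the part of x is at most k
-- (parts are counted once each: representatives must be pairwise in distinct parts)
PartStretchAtMost : ∀ {n} → Graph n → Part n → Fin n → ℕ → Set
PartStretchAtMost G P x k = AtMost (Diff P) (Interferes G P x) k

StretchAtMost : ∀ {n} → Graph n → Part n → ℕ → Set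
StretchAtMost {n} G P k = (x : Fin n) → PartStretchAtMost G P x k

StwAtMost : ∀ {n} → Graph n → ℕ → Set
StwAtMost {n} G k = Σ (PartitionSequence n) λ S →
  (i : ℕ) → i ℕ.≤ n ∸ 1 → StretchAtMost G (seq S i) k

record Edge {n : ℕ} (G : Graph n) : Set where
  constructor edge
  field
    L   : Fin n
    R   : Fin n
    L<R : L <ᶠ R
    isE : Adj G L R
open Edge public

SameEdge : ∀ {n} {G : Graph n} → Edge G → Edge G → Set
SameEdge e f = L e ≡ L f × R e ≡ R f

Cross : ∀ {n} {G : Graph n} → Edge G → Edge G → Set
Cross e f = (L e <ᶠ L f × L f <ᶠ R e × R e <ᶠ R f)
          ⊎ (L f <ᶠ L e × L e <ᶠ R f × R f <ᶠ R e)

OverlapHasKtt : ∀ {n} → Graph n → ℕ → Set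
OverlapHasKtt G t = Σ (Fin t → Edge G) λ A → Σ (Fin t → Edge G) λ B →
  (((i j : Fin t) → SameEdge {G = G} (A i) (A j) → i ≡ j) ×
   ((i j : Fin t) → SameEdge {G = G} (B i) (B j) → i ≡ j) ×
   ((i j : Fin t) → ¬ SameEdge {G = G} (A i) (B j)) ×
   ((i j : Fin t) → Cross {G = G} (A i) (B j)))

{-# OPTIONS --safe #-}
module Submission where

-- Bounded stretch-width excludes K_{t,t}.  By a threshold on left ends, a large K_{t,t} in the
-- overlap graph contains many edges e and many edges f with L(e) < L(f) < R(e) < R(f), and by
-- bounded degree the vertices L(f), and likewise the R(e), may be taken distinct.  Consider the
-- first partition in which some part X holds many L(f) (or many R(e)).  Having more than d
-- vertices, X contains or is red-adjacent to the part of some R(f), so the span of its closed red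
-- neighbourhood contains every R(e); these lie in many different parts, as one merge earlier
-- every part held few of them.
--
-- Excluding K_{t,t} bounds the stretch-width (whatever the degrees).  Use partitions into
-- intervals in which an edge jumping over many parts always joins two singletons, so that
-- red neighbours are close.  If no two consecutive parts can be merged, every two consecutive
-- parts meet a long edge, so each window of w parts carries about w/2 long edges leaving it.
-- Put a window in the gap of a bundle of t long edges, all from just left of the gap to its
-- right, within an interval [lo, hi).  Either t of the edges of the window leave [lo, hi), and
-- then they cross the whole bundle, or t of them form a bundle within a shorter interval.

open import Defs
open import Data.Bool using (T; true; false; _∨_; _∧_)
import Data.Bool.Properties as Bool
open import Data.Empty using (⊥; ⊥-elim)
open import Data.Fin as Fin using (Fin; toℕ; fromℕ<; inject≤) renaming (_<_ to _<ᶠ_; _≤_ to _≤ᶠ_)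
import Data.Fin.Properties as Fin
open import Data.List using (List; []; _∷_; length; filter; map; lookup; tabulate)
open import Data.List.Properties
  using (filter-accept; filter-all; filter-none; length-map; length-tabulate)
open import Data.List.Relation.Unary.All as All using (All; []; _∷_)
import Data.List.Relation.Unary.All.Properties as All
open import Data.List.Relation.Unary.AllPairs as AllPairs using (AllPairs; []; _∷_)
import Data.List.Relation.Unary.AllPairs.Properties as AllPairs
open import Data.List.Membership.Propositional.Properties using (∈-lookup)
open import Data.Nat
open import Data.Nat.Properties
open import Data.Product using (∃; ∃-syntax; _×_; _,_; proj₁; proj₂)
open import Data.Sum using (_⊎_; inj₁; inj₂; [_,_]′; swap)
open import Data.Unit using (⊤; tt)
open import Function using (_∘_; id)
open import Function.Bundles using (_⇔_; mk⇔)
open import Relation.Binary using (tri<; tri≈; tri>)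
open import Relation.Binary.PropositionalEquality
open import Relation.Nullary using (¬_; Dec; yes; no; contradiction; ¬?; _⊎-dec_; _×-dec_)
open import Relation.Nullary.Decidable using (decidable-stable)
open import Relation.Unary using (Decidable)

-- Counting and choosing in lists

module _ {A : Set} where

  count : {P : A → Set} → Decidable P → List A → ℕ
  count P? xs = length (filter P? xs)

  count-∷ : ∀ {P : A → Set} (P? : Decidable P) x xs → count P? xs ≤ count P? (x ∷ xs)
  count-∷ P? x xs with P? x
  ... | yes _ = n≤1+n _
  ... | no _  = ≤-refl

  count-∪ : ∀ {S P Q : A → Set} (S? : Decidable S) (P? : Decidable P) (Q? : Decidable Q) {xs} →
            All (λ x → S x → P x ⊎ Q x) xs → count S? xs ≤ count P? xs + count Q? xs
  count-∪ S? P? Q? [] = z≤n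
  count-∪ S? P? Q? {x ∷ xs} (cover ∷ covers) with S? x
  ... | no _ = ≤-trans (count-∪ S? P? Q? covers) (+-mono-≤ (count-∷ P? x xs) (count-∷ Q? x xs))
  ... | yes s with cover s
  ...   | inj₁ p rewrite filter-accept P? {xs = xs} p =
          s≤s (≤-trans (count-∪ S? P? Q? covers) (+-monoʳ-≤ _ (count-∷ Q? x xs)))
  ...   | inj₂ q rewrite filter-accept Q? {xs = xs} q | +-suc (count P? (x ∷ xs)) (count Q? xs) =
          s≤s (≤-trans (count-∪ S? P? Q? covers) (+-monoˡ-≤ _ (count-∷ P? x xs)))

  count-∪₃ : ∀ {S P Q R : A → Set} (S? : Decidable S) (P? : Decidable P) (Q? : Decidable Q)
             (R? : Decidable R) {xs} → All (λ x → S x → P x ⊎ Q x ⊎ R x) xs →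
             count S? xs ≤ count P? xs + (count Q? xs + count R? xs)
  count-∪₃ S? P? Q? R? {xs} covers = ≤-trans
    (count-∪ S? P? (λ x → Q? x ⊎-dec R? x) covers)
    (+-monoʳ-≤ _ (count-∪ (λ x → Q? x ⊎-dec R? x) Q? R? (All.universal (λ _ → id) xs)))

  everything : Decidable {A = A} (λ _ → ⊤)
  everything _ = yes tt

  count-everything : ∀ xs → count everything xs ≡ length xs
  count-everything xs = cong length (filter-all everything (All.universal (λ _ → tt) xs))

  count-all : ∀ {P : A → Set} (P? : Decidable P) {xs} → All P xs → count P? xs ≡ length xs
  count-all P? Pxs = cong length (filter-all P? Pxs)

  length≤count+count¬ : ∀ {P : A → Set} (P? : Decidable P) xs →
                        length xs ≤ count P? xs + count (¬? ∘ P?) xs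
  length≤count+count¬ P? xs = subst (_≤ count P? xs + count (¬? ∘ P?) xs) (count-everything xs)
    (count-∪ everything P? (¬? ∘ P?) (All.universal (λ x _ → side x) xs))
    where
    side : ∀ x → _
    side x with P? x
    ... | yes p = inj₁ p
    ... | no ¬p = inj₂ ¬p

  head-satisfies : ∀ {P : A → Set} {xs : List A} → 0 < length xs → All P xs → ∃ P
  head-satisfies 0<l (px ∷ _) = _ , px

  lookup-pairs : ∀ {D : A → A → Set} {xs} → AllPairs D xs →
                 ∀ {i j} → i <ᶠ j → D (lookup xs i) (lookup xs j)
  lookup-pairs (d ∷ _) {Fin.zero}  {Fin.suc j} _         = All.lookup d (∈-lookup j)
  lookup-pairs (_ ∷ ds) {Fin.suc i} {Fin.suc j} (s<s i<j) = lookup-pairs ds i<j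

  lookup-separates : ∀ {D : A → A → Set} → (∀ {x y} → D x y → D y x) → ∀ {xs} → AllPairs D xs →
                     ∀ {i j} → ¬ D (lookup xs i) (lookup xs j) → i ≡ j
  lookup-separates D-sym ds {i} {j} ¬D with Fin.<-cmp i j
  ... | tri< i<j _ _ = contradiction (lookup-pairs ds i<j) ¬D
  ... | tri≈ _ i≡j _ = i≡j
  ... | tri> _ _ j<i = contradiction (D-sym (lookup-pairs ds j<i)) ¬D

  count-filter : ∀ {P Q : A → Set} (P? : Decidable P) (Q? : Decidable Q) xs →
                 count Q? (filter P? xs) ≤ count Q? xs
  count-filter P? Q? [] = z≤n
  count-filter P? Q? (x ∷ xs) with P? x
  ... | no _  = ≤-trans (count-filter P? Q? xs) (count-∷ Q? x xs)
  ... | yes _ with Q? x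
  ...   | yes _ = s≤s (count-filter P? Q? xs)
  ...   | no _  = count-filter P? Q? xs

  pairs-with-all : ∀ {P : A → Set} {D : A → A → Set} {xs} → All P xs → AllPairs D xs →
                   AllPairs (λ x y → P x × P y × D x y) xs
  pairs-with-all [] [] = []
  pairs-with-all (px ∷ pxs) (dx ∷ dxs) =
    All.map (λ (py , d) → px , py , d) (All.zip (pxs , dx)) ∷ pairs-with-all pxs dxs

  -- Greedy: keep the head and delete its whole class, at most c elements, each time.
  representatives : ∀ {R : A → A → Set} (R? : ∀ x → Decidable (R x)) {P : A → Set} c r xs →
    All P xs → (∀ x → count (R? x) xs ≤ c) → r * c < length xs →
    ∃[ ys ] (length ys ≡ suc r × All P ys × AllPairs (λ x y → ¬ R x y) ys)
  representatives R? c zero (x ∷ xs) (px ∷ _) _ _ = x ∷ [] , refl , px ∷ [] , [] ∷ []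
  representatives {R} R? {P} c (suc r) xs@(x ∷ _) (px ∷ pxs) small long
    with representatives R? {P = λ y → P y × ¬ R x y} c r rest
           (All.zip (All.filter⁺ (¬? ∘ R? x) (px ∷ pxs) , All.all-filter (¬? ∘ R? x) xs))
           (λ y → ≤-trans (count-filter (¬? ∘ R? x) (R? y) xs) (small y))
           (+-cancelˡ-< c _ _ (<-≤-trans long
             (≤-trans (length≤count+count¬ (R? x) xs) (+-monoˡ-≤ _ (small x)))))
    where
    rest = filter (¬? ∘ R? x) xs
  ... | ys , len , pys , dys = x ∷ ys , cong suc len , px ∷ All.map proj₁ pys , All.map proj₂ pys ∷ dys

length-distinct-interval : ∀ {lo c} (xs : List ℕ) → All (λ y → lo ≤ y × y < lo + c) xs →
                           AllPairs _≢_ xs → length xs ≤ c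
length-distinct-interval {lo} {c} xs bounds distinct = Fin.injective⇒≤ {f = shift} shift-injective
  where
  at : ∀ i → lo ≤ lookup xs i × lookup xs i < lo + c
  at i = All.lookup bounds (∈-lookup i)
  below : ∀ i → lookup xs i ∸ lo < c
  below i = +-cancelˡ-< lo _ _ (subst (_< lo + c) (sym (m+[n∸m]≡n (proj₁ (at i)))) (proj₂ (at i)))
  shift : Fin (length xs) → Fin c
  shift i = fromℕ< (below i)
  shift-injective : ∀ {i j} → shift i ≡ shift j → i ≡ j
  shift-injective {i} {j} eq = lookup-separates (λ x≢y → x≢y ∘ sym) distinct (λ ≢ → ≢
    (∸-cancelʳ-≡ (proj₁ (at i)) (proj₁ (at j)) (Fin.fromℕ<-injective _ _ _ _ eq)))

first-failure : (P : ℕ → Set) → Decidable P → P 0 → ∀ N → ¬ P N →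
                ∃[ i ] (suc i ≤ N × P i × ¬ P (suc i))
first-failure P P? p0 zero ¬pN = contradiction p0 ¬pN
first-failure P P? p0 (suc N) ¬pN with P? N
... | yes pN = N , ≤-refl , pN , ¬pN
... | no ¬pN' with first-failure P P? p0 N ¬pN'
...   | i , i<N , pi , ¬psi = i , m≤n⇒m≤1+n i<N , pi , ¬psi

-- Bounded stretch-width excludes bicliques

Tame : ∀ {n} → Part n → Set
Tame P = (∀ u → Same P u u) × (∀ u v → P u v ≡ P v u)

discrete-tame : ∀ {n} {P : Part n} → Discrete P → Tame P
discrete-tame {P = P} (P-refl , P-eq) = P-refl , P-sym
  where
  P-sym : ∀ u v → P u v ≡ P v u
  P-sym u v with P u v in uv | P v u in vu
  ... | true  | true  = refl
  ... | false | false = refl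
  ... | true  | false with refl ← P-eq u v uv = trans (sym uv) vu
  ... | false | true  with refl ← P-eq v u vu = trans (sym uv) vu

merge-tame : ∀ {n} {P Q : Part n} → MergeOf P Q → Tame P → Tame Q
merge-tame {P = P} {Q} (x , y , _ , Q≡) (P-refl , P-sym) = Q-refl , Q-sym
  where
  Q-refl : ∀ u → Same Q u u
  Q-refl u rewrite Q≡ u u | P-refl u = refl
  Q-sym : ∀ u v → Q u v ≡ Q v u
  Q-sym u v rewrite Q≡ u v | Q≡ v u | P-sym u v =
    cong (P v u ∨_) (trans (Bool.∨-comm (P u x ∧ P v y) _)
      (cong₂ _∨_ (Bool.∧-comm (P u y) _) (Bool.∧-comm (P u x) _)))

-- Each disjunct of `MergeOf` places `v` with `u`, `y` or `x`. Hence one merge at most triples a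
-- bound on the classes.
merge-cover : ∀ {n} {P Q : Part n} (m : MergeOf P Q) → Tame P → ∀ u v → Same Q u v →
              Same P u v ⊎ Same P (proj₁ m) v ⊎ Same P (proj₁ (proj₂ m)) v
merge-cover {P = P} (x , y , _ , Q≡) (_ , P-sym) u v Quv rewrite Q≡ u v | P-sym x v | P-sym y v
  with P u v | P u x | P v y | P u y | P v x
... | true  | _     | _     | _    | _    = inj₁ refl
... | false | _     | _     | _    | true = inj₂ (inj₁ refl)
... | false | _     | true  | _    | _    = inj₂ (inj₂ refl)
... | false | true  | false | true | false = contradiction Quv λ ()
... | false | false | false | true | false = contradiction Quv λ ()
... | false | true  | false | false | false = contradiction Quv λ ()
... | false | false | false | false | false = contradiction Quv λ ()

Same? : ∀ {n} (P : Part n) u → Decidable (Same P u)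
Same? P u v = P u v Bool.≟ true

-- Three times `suc d` bounds what a class holds just after the first crowding merge; `suc k` counts
-- at most `k` interfering parts and the crowded part itself.
overlap-bound : ℕ → ℕ → ℕ
overlap-bound d k = suc k * (suc d + (suc d + suc d))

module _ {n : ℕ} (G : Graph n) where

  Spans : Fin n → Fin n → Set
  Spans v z = ∃[ v̄ ] (Adj G v v̄ × ((v ≤ᶠ z × z ≤ᶠ v̄) ⊎ (v̄ ≤ᶠ z × z ≤ᶠ v)))

  module _ {d k : ℕ} (deg : MaxDegreeAtMost G d) where

    -- A vertex has at most d neighbours, so a part with more than d vertices is red-adjacent
    -- to every other part to which it sends an edge.
    big-part-red : ∀ {P} → Tame P → ∀ {u v v̄} ws → AllPairs _≢_ ws → All (Same P u) ws →
                   d < length ws → Same P u v → Adj G v v̄ → InClosedRedNbhd G P u v̄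
    big-part-red {P} (P-refl , _) {u} {v} {v̄} ws distinct same big Puv vv̄ with P u v̄
    ... | true  = inj₁ refl
    ... | false with All.lookupAny same (All.¬All⇒Any¬ (λ w → adj G v̄ w Bool.≟ true) ws
                       (λ nbrs → <⇒≱ big (deg v̄ ws nbrs distinct)))
    ...   | Puw , ¬v̄w = inj₂ (refl , v , _ , v̄ , v̄ , Puv , Puw , P-refl v̄ , P-refl v̄ , vv̄ ,
                              trans (adj-sym G _ v̄) (Bool.¬-not ¬v̄w))

    -- The crowded part contains some `v` of `vs`, and by `big-part-red` its closed red
    -- neighbourhood contains the neighbours of `v`, so its span covers every `z`. The part itself
    -- takes at most `c` of the `zs`; if more than `k * c` were left, they would represent `suc k`
    -- interfering parts.
    crowded-part : ∀ {P c u} vs zs → Tame P → AllPairs _≢_ vs → AllPairs _≢_ zs →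
                   All (λ v → All (Spans v) zs) vs → d < count (Same? P u) vs →
                   (∀ x → count (Same? P x) zs ≤ c) → PartStretchAtMost G P u k →
                   length zs ≤ suc k * c
    crowded-part {P} {c} {u} vs zs tame vs! zs! spans big small stretch = ≮⇒≥ too-long
      where
      diff? : Decidable (λ z → ¬ Same P u z)
      diff? = ¬? ∘ Same? P u
      ws = filter (Same? P u) vs
      ws! = AllPairs.filter⁺ (Same? P u) vs!
      centre : ∃[ v ] (Same P u v × All (Spans v) zs)
      centre = head-satisfies (≤-<-trans z≤n big)
        (All.zip (All.all-filter (Same? P u) vs , All.filter⁺ (Same? P u) spans))
      Puv = proj₁ (proj₂ centre)
      Target : Fin n → Set
      Target z = ¬ Same P u z × Spans (proj₁ centre) z
      targets : All Target (filter diff? zs)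
      targets = All.zip (All.all-filter diff? zs , All.filter⁺ diff? (proj₂ (proj₂ centre)))
      interferes : ∀ {z} → Target z → Interferes G P u z
      interferes {z} (¬Puz , v̄ , vv̄ , between) =
        Bool.¬-not ¬Puz , z , (z , z , proj₁ tame z , proj₁ tame z , ≤-refl , ≤-refl) , span between
        where
        red = big-part-red tame ws ws! (All.all-filter (Same? P u) vs) big Puv vv̄
        span : _ → InSpan (InClosedRedNbhd G P u) z
        span (inj₁ (v≤z , z≤v̄)) = _ , v̄ , inj₁ Puv , red , v≤z , z≤v̄
        span (inj₂ (v̄≤z , z≤v)) = v̄ , _ , red , inj₁ Puv , v̄≤z , z≤v
      too-long : ¬ suc k * c < length zs
      too-long long with representatives (Same? P) c k (filter diff? zs) targets
        (λ x → ≤-trans (count-filter diff? (Same? P x) zs) (small x))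
        (+-cancelˡ-< c _ _ (<-≤-trans long
          (≤-trans (length≤count+count¬ (Same? P u) zs) (+-monoˡ-≤ _ (small u)))))
      ... | ys , len , ys-target , ys-diff = <⇒≱ (≤-reflexive (sym len))
        (stretch ys (All.map interferes ys-target) (AllPairs.map Bool.¬-not ys-diff))

    -- At the first partition with a class crowded by one list, every class was sparse one merge
    -- earlier. The other list is therefore still spread out, and `crowded-part` bounds its length.
    separated-bound : ∀ vs zs → AllPairs _≢_ vs → AllPairs _≢_ zs →
      All (λ v → All (Spans v) zs) vs → All (λ z → All (Spans z) vs) zs → StwAtMost G k →
      overlap-bound d k < length vs → overlap-bound d k < length zs → ⊥
    separated-bound vs zs vs! zs! vs-span zs-span (S , stretch) many-vs many-zs = result
      where
      long : suc d < length vs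
      long = ≤-<-trans (≤-trans (m≤m+n (suc d) _) (m≤m+n _ _)) many-vs

      tame : ∀ i → i ≤ n ∸ 1 → Tame (seq S i)
      tame zero    _ = discrete-tame (start S)
      tame (suc i) i<N = merge-tame (merges S i i<N) (tame i (<⇒≤ i<N))

      -- The threshold is `suc d` and not `d`, so that singletons are sparse also when `d` is 0.
      Sparse : ℕ → Fin n → Set
      Sparse i u = count (Same? (seq S i) u) vs ≤ suc d × count (Same? (seq S i) u) zs ≤ suc d
      sparse? : ∀ i → Decidable (Sparse i)
      sparse? i u = (_ ≤? _) ×-dec (_ ≤? _)

      start-count : ∀ u xs → AllPairs _≢_ xs → count (Same? (seq S 0) u) xs ≤ suc d
      start-count u xs xs! = ≤-trans (at-most-one _
        (AllPairs.filter⁺ (Same? (seq S 0) u) xs!)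
        (All.map (proj₂ (start S) u _) (All.all-filter (Same? (seq S 0) u) xs))) (s≤s z≤n)
        where
        at-most-one : ∀ ys → AllPairs _≢_ ys → All (u ≡_) ys → length ys ≤ 1
        at-most-one []          _ _ = z≤n
        at-most-one (_ ∷ [])    _ _ = ≤-refl
        at-most-one (_ ∷ _ ∷ _) ((x≢y ∷ _) ∷ _) (u≡x ∷ u≡y ∷ _) = contradiction (trans (sym u≡x) u≡y) x≢y

      end-crowded : ¬ (∀ u → Sparse (n ∸ 1) u)
      end-crowded sparse with centre ← head-satisfies (≤-<-trans z≤n long) vs-span =
        <⇒≱ long (subst (_≤ suc d)
          (count-all (Same? (seq S (n ∸ 1)) u) (All.universal (finish S u) vs)) (proj₁ (sparse u)))
        where u = proj₁ centre

      merged : ∀ {i} (i<N : suc i ≤ n ∸ 1) xs → (∀ x → count (Same? (seq S i) x) xs ≤ suc d) →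
               ∀ x → count (Same? (seq S (suc i)) x) xs ≤ suc d + (suc d + suc d)
      merged {i} i<N xs small x = ≤-trans
        (count-∪₃ (Same? (seq S (suc i)) x) (Same? (seq S i) x) (Same? (seq S i) _) (Same? (seq S i) _)
          (All.universal (merge-cover (merges S i i<N) (tame i (<⇒≤ i<N)) x) xs))
        (+-mono-≤ (small x) (+-mono-≤ (small _) (small _)))

      result : ⊥
      result with first-failure (λ i → ∀ u → Sparse i u) (λ i → Fin.all? (sparse? i))
                    (λ u → start-count u vs vs! , start-count u zs zs!) (n ∸ 1) end-crowded
      ... | i , i<N , sparse , ¬sparse with Fin.¬∀⟶∃¬ n _ (sparse? (suc i)) ¬sparse
      ...   | u , dense with count (Same? (seq S (suc i)) u) vs ≤? suc d
                           | count (Same? (seq S (suc i)) u) zs ≤? suc d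
      ...     | yes p | yes q = dense (p , q)
      ...     | no big | _ = <⇒≱ many-zs
                (crowded-part vs zs (tame (suc i) i<N) vs! zs! vs-span (<-trans (n<1+n d) (≰⇒> big))
                  (merged i<N zs (proj₂ ∘ sparse)) (stretch (suc i) i<N u))
      ...     | yes _ | no big = <⇒≱ many-vs
                (crowded-part zs vs (tame (suc i) i<N) zs! vs! zs-span (<-trans (n<1+n d) (≰⇒> big))
                  (merged i<N vs (proj₁ ∘ sparse)) (stretch (suc i) i<N u))

  -- From bicliques of crossing edges to separated vertex lists

  Different : Edge G → Edge G → Set
  Different e f = ¬ SameEdge {G = G} e f

  Before : Edge G → Edge G → Set
  Before e f = L e <ᶠ L f × L f <ᶠ R e × R e <ᶠ R f

  module _ {d k : ℕ} (deg : MaxDegreeAtMost G d) (stw : StwAtMost G k) where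

    common-left : ∀ {es} → AllPairs Different es → ∀ (e : Edge G) → count (λ f → L e Fin.≟ L f) es ≤ d
    common-left {es} es! e = subst (_≤ d) (length-map R fs) (deg (L e) (map R fs)
      (All.map⁺ (All.map (λ {f} eq → subst (λ v → Adj G v (R f)) (sym eq) (isE f)) same))
      (AllPairs.map⁺ (AllPairs.map (λ { (eq , eq' , ≠) R≡ → ≠ (trans (sym eq) eq' , R≡) })
        (pairs-with-all {D = Different} same (AllPairs.filter⁺ (λ f → L e Fin.≟ L f) {xs = es} es!)))))
      where
      fs = filter (λ f → L e Fin.≟ L f) es
      same = All.all-filter (λ f → L e Fin.≟ L f) es

    common-right : ∀ {es} → AllPairs Different es → ∀ (e : Edge G) → count (λ f → R e Fin.≟ R f) es ≤ d
    common-right {es} es! e = subst (_≤ d) (length-map L fs) (deg (R e) (map L fs)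
      (All.map⁺ (All.map (λ {f} eq → subst (λ v → Adj G v (L f)) (sym eq)
        (trans (adj-sym G (R f) (L f)) (isE f))) same))
      (AllPairs.map⁺ (AllPairs.map (λ { (eq , eq' , ≠) L≡ → ≠ (L≡ , trans (sym eq) eq') })
        (pairs-with-all {D = Different} same (AllPairs.filter⁺ (λ f → R e Fin.≟ R f) {xs = es} es!)))))
      where
      fs = filter (λ f → R e Fin.≟ R f) es
      same = All.all-filter (λ f → R e Fin.≟ R f) es

    M : ℕ
    M = overlap-bound d k

    -- Thinning the left ends of `fs` and the right ends of `es` to distinct vertices costs a factor
    -- `d`. The edge `f` then spans each `R e`, and the edge `e` spans each `L f`.
    no-ordered-crossing : ∀ es fs → AllPairs Different es → AllPairs Different fs →
      All (λ e → All (Before e) fs) es → M * d < length es → M * d < length fs → ⊥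
    no-ordered-crossing es fs es! fs! before many-es many-fs
      with representatives (λ e f → L e Fin.≟ L f) d M fs (All.All-swap before) (common-left {es = fs} fs!) many-fs
    ... | ys , len-ys , before-ys , ys!
      with representatives (λ e f → R e Fin.≟ R f) d M es (All.All-swap before-ys) (common-right {es = es} es!) many-es
    ...   | xs , len-xs , before-xs , xs! =
      separated-bound deg (map L ys) (map R xs) (AllPairs.map⁺ ys!) (AllPairs.map⁺ xs!)
        (All.map⁺ (All.map (λ {f} → All.map⁺ ∘ All.map (λ {e} → left-spans {e} {f})) (All.All-swap before-xs)))
        (All.map⁺ (All.map (λ {e} → All.map⁺ ∘ All.map (λ {f} → right-spans {e} {f})) before-xs))
        stw (longer L ys len-ys) (longer R xs len-xs)
      where
      left-spans : ∀ {e f} → Before e f → Spans (L f) (R e)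
      left-spans {e} {f} (_ , Lf<Re , Re<Rf) = R f , isE f , inj₁ (<⇒≤ Lf<Re , <⇒≤ Re<Rf)
      right-spans : ∀ {e f} → Before e f → Spans (R e) (L f)
      right-spans {e} {f} (Le<Lf , Lf<Re , _) =
        L e , trans (adj-sym G (R e) (L e)) (isE e) , inj₂ (<⇒≤ Le<Lf , <⇒≤ Lf<Re)
      longer : ∀ (g : Edge G → Fin n) zs → length zs ≡ suc M → M < length (map g zs)
      longer g zs len = ≤-reflexive (sym (trans (length-map g zs) len))

    -- Raise a threshold on left ends until one family has `s` edges starting below it. One step
    -- earlier the other family had fewer than `s`, so at least `s` of its edges start at or after
    -- that earlier threshold, and all crossings between the two selections have the same order.
    no-crossing : ∀ s es fs → AllPairs Different es → AllPairs Different fs →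
      All (λ e → All (Cross {G = G} e) fs) es → M * d < s → s + s ≤ length es → s + s ≤ length fs → ⊥
    no-crossing s es fs es! fs! cross s-big many-es many-fs = result
      where
      left<? : ∀ τ → Decidable (λ (e : Edge G) → toℕ (L e) < τ)
      left<? τ e = toℕ (L e) <? τ

      Few : ℕ → Set
      Few τ = count (left<? τ) es < s × count (left<? τ) fs < s

      -- At most i on one side and at least i on the other: crossing edges have distinct
      -- left ends, so the edges of the first kind all start before those of the second.
      ordered : ∀ i es fs → AllPairs Different es → AllPairs Different fs →
        All (λ e → All (Cross {G = G} e) fs) es → s + s ≤ length fs →
        s ≤ count (left<? (suc i)) es → count (left<? i) fs < s → ⊥
      ordered i es fs es! fs! cross many-fs many few =
        no-ordered-crossing (filter (left<? (suc i)) es) (filter (¬? ∘ left<? i) fs)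
          (AllPairs.filter⁺ _ es!) (AllPairs.filter⁺ _ fs!)
          (All.map (λ {e} (Le≤i , crosses) → All.map (λ {f} → before {e} {f} Le≤i)
              (All.zip (All.all-filter (¬? ∘ left<? i) fs , All.filter⁺ (¬? ∘ left<? i) crosses)))
            (All.zip (All.all-filter (left<? (suc i)) es , All.filter⁺ (left<? (suc i)) cross)))
          (<-≤-trans s-big many)
          (<-≤-trans s-big (+-cancelˡ-≤ s _ _ (≤-trans many-fs
            (≤-trans (length≤count+count¬ (left<? i) fs) (+-monoˡ-≤ _ (<⇒≤ few))))))
        where
        before : ∀ {e f} → toℕ (L e) < suc i → (¬ toℕ (L f) < i) × Cross {G = G} e f → Before e f
        before _         (_     , inj₁ b) = b
        before (s≤s Le≤i) (Lf≮i , inj₂ (Lf<Le , _)) = contradiction (<-≤-trans Lf<Le Le≤i) Lf≮i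

      result : ⊥
      result with first-failure Few (λ τ → (_ <? _) ×-dec (_ <? _)) (none es , none fs) n
                    (λ { (few , _) → <⇒≱ few (≤-trans (m≤m+n s s) (≤-trans many-es (≤-reflexive
                      (sym (count-all (left<? n) (All.universal (λ e → Fin.toℕ<n (L e)) es)))))) })
        where
        none : ∀ es → count (left<? 0) es < s
        none es rewrite filter-none (left<? 0) (All.universal (λ _ ()) es) = ≤-<-trans z≤n s-big
      ... | i , _ , (few-es , few-fs) , ¬few
        with count (left<? (suc i)) es <? s | count (left<? (suc i)) fs <? s
      ...   | yes p | yes q = ¬few (p , q)
      ...   | no many | _ = ordered i es fs es! fs! cross many-fs (≮⇒≥ many) few-fs
      ...   | yes _ | no many = ordered i fs es fs! es!
              (All.map (All.map swap) (All.All-swap cross)) many-es (≮⇒≥ many) few-es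

    stw⇒Ktt-free : ¬ OverlapHasKtt G (suc (overlap-bound d k * d) + suc (overlap-bound d k * d))
    stw⇒Ktt-free (A , B , A-inj , B-inj , _ , cross) =
      no-crossing (suc (M * d)) (tabulate A) (tabulate B)
        (AllPairs.tabulate⁺ {f = A} (λ i≢j same → i≢j (A-inj _ _ same)))
        (AllPairs.tabulate⁺ {f = B} (λ i≢j same → i≢j (B-inj _ _ same)))
        (All.tabulate⁺ {f = A} (λ i → All.tabulate⁺ {f = B} (cross i)))
        ≤-refl (≤-reflexive (sym (length-tabulate A))) (≤-reflexive (sym (length-tabulate B)))

-- Interval partitions

-- The renumbering when intervals `i` and `suc i` merge: numbers up to `i` stay, larger ones drop by
-- one.
squash : ℕ → ℕ → ℕ
squash i       zero    = zero
squash zero    (suc x) = x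
squash (suc i) (suc x) = suc (squash i x)

squash≤ : ∀ i x → squash i x ≤ x
squash≤ i       zero    = z≤n
squash≤ zero    (suc x) = n≤1+n x
squash≤ (suc i) (suc x) = s≤s (squash≤ i x)

squash-mono : ∀ i {x y} → x ≤ y → squash i x ≤ squash i y
squash-mono i       z≤n       = z≤n
squash-mono zero    (s≤s x≤y) = x≤y
squash-mono (suc i) (s≤s x≤y) = s≤s (squash-mono i x≤y)

squash-< : ∀ i {x m} → i ≤ m → x < 2 + m → squash i x < suc m
squash-< i       {zero}          _         _         = z<s
squash-< zero    {suc x}         _         (s≤s x<m) = x<m
squash-< (suc i) {suc x} {suc m} (s≤s i≤m) (s≤s x<m) = s≤s (squash-< i i≤m x<m)

-- Merging never lengthens a distance, so an edge that is long afterwards was long before.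
squash-gap : ∀ i {x y c} → squash i x + c < squash i y → x + c < y
squash-gap i       {zero}  {y}     gap       = <-≤-trans gap (squash≤ i y)
squash-gap zero    {suc x} {suc y} gap       = s≤s gap
squash-gap (suc i) {suc x} {suc y} (s≤s gap) = s≤s (squash-gap i {x} gap)

unsquash : ∀ i j → ∃[ x ] (squash i x ≡ j × x ≤ suc j)
unsquash zero    j       = suc j , refl , ≤-refl
unsquash (suc i) zero    = zero , refl , z≤n
unsquash (suc i) (suc j) with unsquash i j
... | x , eq , x≤1+j = suc x , cong suc eq , s≤s x≤1+j

squash-collision : ∀ i x y → squash i x ≡ squash i y → x ≡ y ⊎ (x ≡ i ⊎ x ≡ suc i)
squash-collision i       zero          zero    _  = inj₁ refl
squash-collision zero    zero          (suc y) _  = inj₂ (inj₁ refl)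
squash-collision zero    (suc zero)    zero    _  = inj₂ (inj₂ refl)
squash-collision zero    (suc x)       (suc y) eq = inj₁ (cong suc eq)
squash-collision (suc i) (suc x)       (suc y) eq with squash-collision i x y (suc-injective eq)
... | inj₁ refl        = inj₁ refl
... | inj₂ (inj₁ refl) = inj₂ (inj₁ refl)
... | inj₂ (inj₂ refl) = inj₂ (inj₂ refl)

squash-merges : ∀ i x y → (squash i x ≡ᵇ squash i y) ≡
  ((x ≡ᵇ y) ∨ (((x ≡ᵇ i) ∧ (y ≡ᵇ suc i)) ∨ ((x ≡ᵇ suc i) ∧ (y ≡ᵇ i))))
squash-merges i       zero          zero          = refl
squash-merges zero    zero          (suc zero)    = refl
squash-merges zero    zero          (suc (suc y)) = refl
squash-merges zero    (suc zero)    zero          = refl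
squash-merges zero    (suc (suc x)) zero          = refl
squash-merges zero    (suc x)       (suc y)       =
  sym (trans (cong ((x ≡ᵇ y) ∨_) (Bool.∧-zeroʳ (x ≡ᵇ 0))) (Bool.∨-identityʳ (x ≡ᵇ y)))
squash-merges (suc i) zero          (suc y)       = refl
squash-merges (suc i) (suc x)       zero          =
  sym (trans (cong (((x ≡ᵇ i) ∧ false) ∨_) (Bool.∧-zeroʳ (x ≡ᵇ suc i)))
    (trans (Bool.∨-identityʳ _) (Bool.∧-zeroʳ (x ≡ᵇ i))))
squash-merges (suc i) (suc x)       (suc y)       = squash-merges i x y

≡ᵇ-true⇒≡ : ∀ {x y} → (x ≡ᵇ y) ≡ true → x ≡ y
≡ᵇ-true⇒≡ {x} {y} eq = ≡ᵇ⇒≡ x y (subst T (sym eq) tt)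

≡ᵇ-refl : ∀ x → (x ≡ᵇ x) ≡ true
≡ᵇ-refl zero    = refl
≡ᵇ-refl (suc x) = ≡ᵇ-refl x

n≢ᵇ1+n : ∀ x → (x ≡ᵇ suc x) ≡ false
n≢ᵇ1+n zero    = refl
n≢ᵇ1+n (suc x) = n≢ᵇ1+n x

-- Layouts, their stretch, and merging in them

module _ {n : ℕ} (G : Graph n) (reach : ℕ) where

  Far : ℕ → ℕ → Set
  Far x y = x + reach < y ⊎ y + reach < x

  far? : ∀ x y → Dec (Far x y)
  far? x y = (_ <? _) ⊎-dec (_ <? _)

  ¬far-self : ∀ x → ¬ Far x x
  ¬far-self x = [ m+n≮m x reach , m+n≮m x reach ]′

  squash-far : ∀ i {x y} → Far (squash i x) (squash i y) → Far x y
  squash-far i {x} (inj₁ gap) = inj₁ (squash-gap i {x} gap)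
  squash-far i {x} {y} (inj₂ gap) = inj₂ (squash-gap i {y} gap)

  -- A partition into m intervals, the vertex u lying in the interval number idx u.
  record Layout (m : ℕ) : Set where
    field
      idx      : Fin n → ℕ
      idx-mono : ∀ {u v} → u ≤ᶠ v → idx u ≤ idx v
      idx-<    : ∀ u → idx u < m
      onto     : ∀ i → i < m → ∃[ u ] idx u ≡ i
      far-singleton : ∀ {u v} → Adj G u v → Far (idx u) (idx v) → ∀ w → idx w ≡ idx u → w ≡ u

    part : Part n
    part u v = idx u ≡ᵇ idx v

    idx-reflects-< : ∀ {u v} → idx u < idx v → u <ᶠ v
    idx-reflects-< {u} {v} iu<iv = ≰⇒> (λ v≤u → <⇒≱ iu<iv (idx-mono v≤u))

    -- A long edge joins two singleton parts, so it does not make them inhomogeneous.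
    red-near : ∀ {x w} → InClosedRedNbhd G part x w → ¬ Far (idx x) (idx w)
    red-near {x} (inj₁ same) far =
      ¬far-self (idx x) (subst (Far (idx x)) (sym (≡ᵇ-true⇒≡ {idx x} same)) far)
    red-near {x} {w} (inj₂ (_ , u , u' , v , v' , xu , xu' , wv , wv' , uv , ¬u'v')) far
      with xu ← ≡ᵇ-true⇒≡ {idx x} xu | xu' ← ≡ᵇ-true⇒≡ {idx x} xu'
         | wv ← ≡ᵇ-true⇒≡ {idx w} wv | wv' ← ≡ᵇ-true⇒≡ {idx w} wv'
      with uv-far ← subst₂ Far xu wv far
      with refl ← far-singleton uv uv-far u' (trans (sym xu') xu)
         | refl ← far-singleton (trans (adj-sym G v u) uv) (swap uv-far) v' (trans (sym wv') wv)
      = contradiction (trans (sym uv) ¬u'v') λ ()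

    -- A conflict gives a vertex `w` in the interval of `y` that lies between two vertices of the
    -- closed red neighbourhood, both within `reach` of `x` by `red-near`. So interfering intervals
    -- have their numbers among `2 * reach + 1` values.
    stretch-bound : StretchAtMost G part (reach + suc reach)
    stretch-bound x ys interfere distinct = subst (_≤ reach + suc reach) (length-map idx ys)
      (length-distinct-interval {idx x ∸ reach} (map idx ys)
        (All.map⁺ (All.map near interfere))
        (AllPairs.map⁺ (AllPairs.map separate distinct)))
      where
      separate : ∀ {u v} → Diff part u v → idx u ≢ idx v
      separate {u} {v} diff eq rewrite eq | ≡ᵇ-refl (idx v) = contradiction diff λ ()
      near : ∀ {y} → Interferes G part x y →
             idx x ∸ reach ≤ idx y × idx y < (idx x ∸ reach) + (reach + suc reach)
      near {y} (_ , w , (a , b , ya , yb , a≤w , w≤b) , (a' , b' , xa' , xb' , a'≤w , w≤b'))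
        = m≤n+o⇒m∸n≤o (idx x) reach (≤-trans (≮⇒≥ (red-near xa' ∘ inj₂)) (≤-trans
            (+-monoˡ-≤ reach (≤-trans (idx-mono a'≤w) w≤y)) (≤-reflexive (+-comm _ reach))))
        , ≤-<-trans (≤-trans y≤w (≤-trans (idx-mono w≤b') (≮⇒≥ (red-near xb' ∘ inj₁))))
            (≤-trans (s≤s (+-monoˡ-≤ reach (m≤n+m∸n (idx x) reach)))
              (≤-reflexive (regroup (idx x ∸ reach))))
        where
        w≤y : idx w ≤ idx y
        w≤y = subst (idx w ≤_) (sym (≡ᵇ-true⇒≡ {idx y} yb)) (idx-mono w≤b)
        y≤w : idx y ≤ idx w
        y≤w = subst (_≤ idx w) (sym (≡ᵇ-true⇒≡ {idx y} ya)) (idx-mono a≤w)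
        regroup : ∀ l → suc (reach + l + reach) ≡ l + (reach + suc reach)
        regroup l = trans (cong (λ s → suc (s + reach)) (+-comm reach l))
          (trans (sym (+-suc (l + reach) reach)) (+-assoc l reach (suc reach)))

  discrete-layout : Layout n
  discrete-layout = record
    { idx = toℕ ; idx-mono = id ; idx-< = Fin.toℕ<n
    ; onto = λ i i<n → fromℕ< i<n , Fin.toℕ-fromℕ< i<n
    ; far-singleton = λ _ _ _ → Fin.toℕ-injective }

  module _ {m : ℕ} (Λ : Layout (2 + m)) where
    open Layout Λ

    -- An obstruction to merging `i` with `suc i`: an edge still long in the new numbering, one end
    -- of which would no longer be a singleton.
    Blocks : ℕ → Fin n → Fin n → Set
    Blocks i u v = Adj G u v × (idx u ≡ i ⊎ idx u ≡ suc i) × Far (squash i (idx u)) (squash i (idx v))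

    Blocked : ℕ → Set
    Blocked i = ∃[ u ] ∃[ v ] Blocks i u v

    blocked? : Decidable Blocked
    blocked? i = Fin.any? λ u → Fin.any? λ v →
      (adj G u v Bool.≟ true) ×-dec ((idx u ≟ i) ⊎-dec (idx u ≟ suc i)) ×-dec far? _ _

    module _ {i : ℕ} (i≤m : i ≤ m) where

      merge-layout : ¬ Blocked i → Layout (suc m)
      merge-layout free = record
        { idx      = λ u → squash i (idx u)
        ; idx-mono = λ u≤v → squash-mono i (idx-mono u≤v)
        ; idx-<    = λ u → squash-< i i≤m (idx-< u)
        ; onto     = onto'
        ; far-singleton = singleton }
        where
        onto' : ∀ j → j < suc m → ∃[ u ] squash i (idx u) ≡ j
        onto' j j<1+m with unsquash i j
        ... | x , eq , x≤1+j with onto x (s≤s (≤-trans x≤1+j j<1+m))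
        ...   | u , refl = u , eq
        singleton : ∀ {u v} → Adj G u v → Far (squash i (idx u)) (squash i (idx v)) →
                    ∀ w → squash i (idx w) ≡ squash i (idx u) → w ≡ u
        -- Either the two vertices already shared an interval, or `u` lies in the merged one and its
        -- long edge blocks the merge.
        singleton {u} {v} uv far w eq with squash-collision i (idx u) (idx w) (sym eq)
        ... | inj₁ same    = far-singleton uv (squash-far i far) w (sym same)
        ... | inj₂ touches = contradiction (u , v , uv , touches , far) free

      merge-layout-merges : (free : ¬ Blocked i) → MergeOf part (Layout.part (merge-layout free))
      merge-layout-merges free with onto i (s≤s (m≤n⇒m≤1+n i≤m)) | onto (suc i) (s≤s (s≤s i≤m))
      ... | x , idx-x | y , idx-y = x , y , diff , merged
        where
        diff : Diff part x y
        diff rewrite idx-x | idx-y = n≢ᵇ1+n i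
        merged : ∀ u v → (squash i (idx u) ≡ᵇ squash i (idx v)) ≡
                 (part u v ∨ ((part u x ∧ part v y) ∨ (part u y ∧ part v x)))
        merged u v rewrite idx-x | idx-y = squash-merges i (idx u) (idx v)

-- Descent on bundles of long edges

-- Three kinds of `t` edges call for `3 * t` disjoint pairs of intervals in a window. A reach of two
-- windows leaves a whole window free between a window and the far end of a long edge meeting it.
window-size reach-for : ℕ → ℕ
window-size t = (t + (t + t)) * 2
reach-for t = window-size t + window-size t

module _ {n : ℕ} (G : Graph n) (t : ℕ) (Ktt-free : ¬ OverlapHasKtt G t) where

  Crossing : Edge G → Edge G → Set
  Crossing = Cross {G = G}

  different-sym : ∀ {e f} → Different G e f → Different G f e
  different-sym e≢f (Ll , Rr) = e≢f (sym Ll , sym Rr)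

  Many : (Edge G → Set) → Set
  Many P = ∃[ es ] (t ≤ length es × All P es × AllPairs (Different G) es)

  -- The biclique with empty sides is in every overlap graph. Positivity makes bundles nonempty.
  0<t : 0 < t
  0<t = n≢0⇒n>0 λ t≡0 → Ktt-free (subst (OverlapHasKtt G) (sym t≡0)
    ((λ ()) , (λ ()) , (λ ()) , (λ ()) , (λ ()) , (λ ())))

  some : ∀ {P} → Many P → ∃ P
  some (_ , t≤l , Pes , _) = head-satisfies (≤-trans 0<t t≤l) Pes

  no-many-crossing : ∀ {P Q} → (∀ {e f} → P e → Q f → Crossing e f) → Many P → Many Q → ⊥
  no-many-crossing cross (es , t≤es , Pes , es!) (fs , t≤fs , Qfs , fs!) = Ktt-free
    ( (λ i → lookup es (inject≤ i t≤es)) , (λ i → lookup fs (inject≤ i t≤fs))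
    , (λ i j same → Fin.inject≤-injective t≤es t≤es i j
        (lookup-separates (λ {e} {f} → different-sym {e} {f}) es! (λ ≢ → ≢ same)))
    , (λ i j same → Fin.inject≤-injective t≤fs t≤fs i j
        (lookup-separates (λ {e} {f} → different-sym {e} {f}) fs! (λ ≢ → ≢ same)))
    , (λ i j same → crossing-different (lookup es (inject≤ i t≤es)) (lookup fs (inject≤ j t≤fs)) (crosses i j) (proj₁ same))
    , crosses )
    where
    crosses : ∀ i j → Crossing (lookup es (inject≤ i t≤es)) (lookup fs (inject≤ j t≤fs))
    crosses i j = cross (All.lookup Pes (∈-lookup _)) (All.lookup Qfs (∈-lookup _))
    crossing-different : ∀ e f → Crossing e f → L e ≢ L f
    crossing-different e f (inj₁ (Le<Lf , _)) eq = <⇒≢ Le<Lf (cong toℕ eq)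
    crossing-different e f (inj₂ (Lf<Le , _)) eq = <⇒≢ Lf<Le (cong toℕ (sym eq))

  private
    window = window-size t
    reach  = reach-for t

  module _ {m : ℕ} (Λ : Layout G reach m) where
    open Layout Λ

    l r : Edge G → ℕ
    l e = idx (L e)
    r e = idx (R e)

    Long : Edge G → Set
    Long e = l e + reach < r e

    Touches : ℕ → ℕ → Edge G → Set
    Touches p q e = (p ≤ l e × l e < q) ⊎ (p ≤ r e × r e < q)

    LongFrom : ℕ → ℕ → Edge G → Set
    LongFrom p q e = Long e × Touches p q e

    Thick : ℕ → ℕ → ℕ → Edge G → Set
    Thick lo p hi e = (lo ≤ l e × l e < p) × (p + window ≤ r e × r e < hi)

    Escapes : ℕ → ℕ → ℕ → Edge G → Set
    Escapes lo p hi e = LongFrom p (p + window) e × (l e < lo ⊎ hi ≤ r e)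

    StaysLeft : ℕ → ℕ → Edge G → Set
    StaysLeft lo p e = (lo ≤ l e × l e + window < p) × (p ≤ r e × r e < p + window)

    long-clears-window : ∀ {e p} → Long e → p ≤ l e → p + window + window < r e
    long-clears-window {e} {p} long p≤l = ≤-<-trans
      (≤-trans (≤-reflexive (+-assoc p window window)) (+-monoˡ-≤ reach p≤l)) long

    module Stuck (stuck : ∀ i → suc i < m → ∃ (LongFrom i (2 + i))) where

      pair-shift : ∀ p j → p + suc j * 2 ≡ 2 + p + j * 2
      pair-shift p j = trans (+-suc p (suc (j * 2))) (cong suc (+-suc p (j * 2)))

      -- Each disjoint pair of intervals supplies a long edge. An edge serving two pairs would have
      -- both ends in the window, which is no wider than `reach`.
      window-edges : ∀ j p → p + j * 2 ≤ m → j * 2 ≤ reach →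
        ∃[ es ] (length es ≡ j × All (LongFrom p (p + j * 2)) es × AllPairs (Different G) es)
      window-edges zero    p _   _     = [] , refl , [] , []
      window-edges (suc j) p fits short
        with stuck p (≤-trans (≤-trans (s≤s (s≤s (m≤m+n p (j * 2)))) (≤-reflexive (sym (pair-shift p j)))) fits)
           | window-edges j (2 + p) (≤-trans (≤-reflexive (sym (pair-shift p j))) fits)
               (≤-trans (m≤n+m (j * 2) 2) short)
      ... | e , e-long , e-touches | es , len , es-long , es! =
        e ∷ es , cong suc len , (e-long , widen-head e-touches) ∷ All.map (λ {f} → widen {f}) es-long ,
        All.map (λ {f} → differs {f}) es-long ∷ es!
        where
        shift = pair-shift p j
        end : ∀ {x} → x < 2 + p → x < p + suc j * 2
        end x<2+p = <-≤-trans x<2+p (≤-trans (m≤m+n (2 + p) (j * 2)) (≤-reflexive (sym shift)))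
        widen-head : Touches p (2 + p) e → Touches p (p + suc j * 2) e
        widen-head (inj₁ (p≤l , l<)) = inj₁ (p≤l , end l<)
        widen-head (inj₂ (p≤r , r<)) = inj₂ (p≤r , end r<)
        widen : ∀ {f} → LongFrom (2 + p) (2 + p + j * 2) f → LongFrom p (p + suc j * 2) f
        widen (long , inj₁ (p≤l , l<)) = long ,
          inj₁ (≤-trans (m≤n+m p 2) p≤l , <-≤-trans l< (≤-reflexive (sym shift)))
        widen (long , inj₂ (p≤r , r<)) = long ,
          inj₂ (≤-trans (m≤n+m p 2) p≤r , <-≤-trans r< (≤-reflexive (sym shift)))
        differs : ∀ {f} → LongFrom (2 + p) (2 + p + j * 2) f → Different G e f
        differs {f} (f-long , f-touches) (L≡ , R≡) = clash e-touches f-touches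
          where
          l≡ : l e ≡ l f
          l≡ = cong idx L≡
          r≡ : r e ≡ r f
          r≡ = cong idx R≡
          clash : Touches p (2 + p) e → Touches (2 + p) (2 + p + j * 2) f → ⊥
          clash (inj₁ (_ , l<)) (inj₁ (≤l , _)) = <⇒≱ l< (≤-trans ≤l (≤-reflexive (sym l≡)))
          clash (inj₂ (_ , r<)) (inj₂ (≤r , _)) = <⇒≱ r< (≤-trans ≤r (≤-reflexive (sym r≡)))
          clash (inj₂ (_ , r<)) (inj₁ (≤l , _)) = <⇒≱ r<
            (≤-trans ≤l (≤-trans (m≤m+n (l f) reach) (≤-trans (<⇒≤ f-long) (≤-reflexive (sym r≡)))))
          clash (inj₁ (p≤l , _)) (inj₂ (_ , r<)) = <⇒≱ e-long (≤-trans (≤-reflexive r≡)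
            (≤-trans (<⇒≤ r<) (≤-trans (≤-reflexive (sym shift)) (+-mono-≤ p≤l short))))

      -- Among `3 * t` long edges, `t` are of one kind. An edge that starts in the window and does
      -- not escape clears a further window, the gap of the new bundle; one that ends in the window
      -- starts more than a window before `p`.
      classify : ∀ lo p hi → p + window ≤ m →
        Many (Escapes lo p hi) ⊎ Many (Thick p (p + window) hi) ⊎ Many (StaysLeft lo p)
      classify lo p hi fits with window-edges (t + (t + t)) p fits (m≤m+n window window)
      ... | es , len , es-long , es! = result
        where
        escapes? : Decidable (λ e → l e < lo ⊎ hi ≤ r e)
        escapes? e = (_ <? _) ⊎-dec (_ ≤? _)
        right? : Decidable (λ e → ¬ (l e < lo ⊎ hi ≤ r e) × p ≤ l e)
        right? e = ¬? (escapes? e) ×-dec (_ ≤? _)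
        left? : Decidable (λ e → ¬ (l e < lo ⊎ hi ≤ r e) × ¬ p ≤ l e)
        left? e = ¬? (escapes? e) ×-dec ¬? (_ ≤? _)

        select : ∀ {P Q : Edge G → Set} (P? : Decidable P) →
                 (∀ {e} → P e × LongFrom p (p + window) e → Q e) → t ≤ count P? es → Many Q
        select P? imp many = filter P? es , many ,
          All.map imp (All.zip (All.all-filter P? es , All.filter⁺ P? es-long)) , AllPairs.filter⁺ P? es!

        right : ∀ {e} → (¬ (l e < lo ⊎ hi ≤ r e) × p ≤ l e) × LongFrom p (p + window) e →
                Thick p (p + window) hi e
        right {e} ((stays , p≤l) , long , touches) =
          (p≤l , starts touches) , (<⇒≤ (long-clears-window {e} long p≤l) , ≰⇒> (stays ∘ inj₂))
          where
          starts : Touches p (p + window) e → l e < p + window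
          starts (inj₁ (_ , l<)) = l<
          starts (inj₂ (_ , r<)) = ≤-<-trans (≤-trans (m≤m+n (l e) reach) (<⇒≤ long)) r<

        left : ∀ {e} → (¬ (l e < lo ⊎ hi ≤ r e) × ¬ p ≤ l e) × LongFrom p (p + window) e →
               StaysLeft lo p e
        left ((_ , p≰l) , _ , inj₁ (p≤l , _)) = contradiction p≤l p≰l
        left {e} ((stays , _) , long , inj₂ (p≤r , r<)) = (≮⇒≥ (stays ∘ inj₁) , room) , (p≤r , r<)
          where
          room : l e + window < p
          room = +-cancelʳ-< window _ _
            (≤-<-trans (≤-reflexive (+-assoc (l e) window window)) (<-trans long r<))

        all-cases : ∀ e → ⊤ → (l e < lo ⊎ hi ≤ r e) ⊎ (¬ (l e < lo ⊎ hi ≤ r e) × p ≤ l e) ⊎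
                    (¬ (l e < lo ⊎ hi ≤ r e) × ¬ p ≤ l e)
        all-cases e _ with escapes? e | p ≤? l e
        ... | yes esc | _       = inj₁ esc
        ... | no ¬esc | yes p≤l = inj₂ (inj₁ (¬esc , p≤l))
        ... | no ¬esc | no p≰l  = inj₂ (inj₂ (¬esc , p≰l))

        result : _
        result with t ≤? count escapes? es | t ≤? count right? es | t ≤? count left? es
        ... | yes many | _ | _ = inj₁ (select escapes? (λ (esc , long) → long , esc) many)
        ... | no _ | yes many | _ = inj₂ (inj₁ (select right? (λ {e} → right {e}) many))
        ... | no _ | no _ | yes many = inj₂ (inj₂ (select left? (λ {e} → left {e}) many))
        ... | no few | no few' | no few'' = contradiction
          (≤-trans (≤-reflexive (trans (sym len) (sym (count-everything es))))
            (count-∪₃ everything escapes? right? left? (All.universal all-cases es)))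
          (<⇒≱ (+-mono-< (≰⇒> few) (+-mono-< (≰⇒> few') (≰⇒> few''))))

      -- An edge from the gap to outside `[lo, hi)` separates the two ends of a bundle edge. In the
      -- last two clauses a single end would be both in the gap and outside `[lo, hi)`.
      escape-crosses : ∀ {lo p hi e f} → Thick lo p hi e → Escapes lo p hi f → Crossing e f
      escape-crosses {e = e} {f} ((_ , le<p) , q≤re , re<hi) ((long , inj₁ (p≤lf , lf<q)) , inj₂ hi≤rf) =
        inj₁ (idx-reflects-< (<-≤-trans le<p p≤lf) , idx-reflects-< (<-≤-trans lf<q q≤re) ,
              idx-reflects-< (<-≤-trans re<hi hi≤rf))
      escape-crosses {e = e} {f} ((lo≤le , le<p) , q≤re , _) ((long , inj₂ (p≤rf , rf<q)) , inj₁ lf<lo) =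
        inj₂ (idx-reflects-< (<-≤-trans lf<lo lo≤le) , idx-reflects-< (<-≤-trans le<p p≤rf) ,
              idx-reflects-< (<-≤-trans rf<q q≤re))
      escape-crosses ((lo≤le , le<p) , _) ((_ , inj₁ (p≤lf , _)) , inj₁ lf<lo) =
        contradiction (<-≤-trans le<p p≤lf) (<-asym (<-≤-trans lf<lo lo≤le))
      escape-crosses (_ , q≤re , re<hi) ((_ , inj₂ (_ , rf<q)) , inj₂ hi≤rf) =
        contradiction (<-≤-trans rf<q q≤re) (<-asym (<-≤-trans re<hi hi≤rf))

      stays-left-thick : ∀ {lo p} → Many (StaysLeft lo p) → Many (Thick lo (p ∸ window) (p + window))
      stays-left-thick {lo} {p} many@(es , t≤ , left , es!) = es , t≤ , All.map (λ {e} → thick {e}) left , es!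
        where
        -- The subtraction in `p ∸ window` must not truncate; any edge of the nonempty bundle
        -- ensures this.
        window≤p : window ≤ p
        window≤p = let e , (_ , room) , _ = some many in ≤-trans (m≤n+m window (l e)) (<⇒≤ room)
        thick : ∀ {e} → StaysLeft lo p e → Thick lo (p ∸ window) (p + window) e
        thick {e} ((lo≤l , room) , p≤r , r<) =
          (lo≤l , m+n≤o⇒m≤o∸n (suc (l e)) room) , ≤-trans (≤-reflexive (m∸n+n≡m window≤p)) p≤r , r<

      -- Induction on a bound for the length of `[lo, hi)`. A bundle to the right raises `lo` to
      -- `p`, one to the left lowers `hi` to `p + window`; an edge of the present bundle shows that
      -- either change is strict.
      no-thick : ∀ fuel lo p hi → hi ≤ lo + fuel → ¬ Many (Thick lo p hi)
      no-thick fuel lo p hi short bundle with some bundle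
      no-thick zero lo p hi short bundle | e , (lo≤l , l<p) , q≤r , r<hi =
        <⇒≱ (≤-<-trans (≤-trans lo≤l (≤-trans (<⇒≤ l<p) (≤-trans (m≤m+n p window) q≤r))) r<hi)
          (≤-trans short (≤-reflexive (+-identityʳ lo)))
      no-thick (suc fuel) lo p hi short bundle | e , (lo≤l , l<p) , q≤r , r<hi
        with classify lo p hi (≤-trans q≤r (<⇒≤ (idx-< (R e))))
      ... | inj₁ escaping = no-many-crossing (λ {e} {f} → escape-crosses {e = e} {f}) bundle escaping
      ... | inj₂ (inj₁ right) = no-thick fuel p (p + window) hi
        (≤-trans short (≤-trans (≤-reflexive (+-suc lo fuel)) (+-monoˡ-≤ fuel (≤-<-trans lo≤l l<p)))) right
      ... | inj₂ (inj₂ left) = no-thick fuel lo (p ∸ window) (p + window)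
        (≤-pred (≤-trans (≤-<-trans q≤r r<hi) (≤-trans short (≤-reflexive (+-suc lo fuel)))))
        (stays-left-thick left)

      -- The descent starts at the window at 0, with `lo` 0 and `hi` equal to `m`: no edge escapes
      -- and none comes from the left, so a bundle to the right remains.
      impossible : 2 ≤ m → ⊥
      -- One long edge shows that there is room for a whole window.
      impossible 2≤m with stuck 0 2≤m
      ... | e , long , _ with classify 0 0 m (≤-trans (≤-trans (m≤m+n window window) (m≤n+m reach (l e)))
                                (<⇒≤ (<-trans long (idx-< (R e)))))
      ...   | inj₁ escaping with some escaping
      ...     | f , _ , inj₂ m≤r = <⇒≱ (idx-< (R f)) m≤r
      impossible 2≤m | _ | inj₂ (inj₁ right) = no-thick m 0 window m ≤-refl right
      impossible 2≤m | _ | inj₂ (inj₂ left) with some left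
      ... | _ , (_ , ()) , _

  -- If every merge were blocked, any two consecutive intervals would meet an edge that is long
  -- after their merge, hence already long by `squash-far`; `Stuck` excludes this.
  mergeable : ∀ {m} (Λ : Layout G reach (2 + m)) → ∃[ i ] (i ≤ m × ¬ Blocked G reach Λ i)
  mergeable {m} Λ with anyUpTo? (λ i → ¬? (blocked? G reach Λ i)) (suc m)
  ... | yes (i , s≤s i≤m , free) = i , i≤m , free
  ... | no all-blocked = ⊥-elim (Stuck.impossible Λ stuck (s≤s (s≤s z≤n)))
    where
    open Layout Λ
    stuck : ∀ i → suc i < 2 + m → ∃ (LongFrom Λ i (2 + i))
    stuck i (s≤s i<1+m) with decidable-stable (blocked? G reach Λ i) (λ free → all-blocked (i , i<1+m , free))
    ... | u , v , uv , touches , far = pick (squash-far G reach i far)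
      where
      between : i ≤ idx u × idx u < 2 + i
      between = [ (λ eq → ≤-reflexive (sym eq) , s≤s (≤-trans (≤-reflexive eq) (n≤1+n i)))
                , (λ eq → ≤-trans (n≤1+n i) (≤-reflexive (sym eq)) , s≤s (≤-reflexive eq)) ]′ touches
      ahead : ∀ {x y} → idx x + reach < idx y → x <ᶠ y
      ahead gap = idx-reflects-< (≤-<-trans (m≤m+n _ reach) gap)
      pick : Far G reach (idx u) (idx v) → ∃ (LongFrom Λ i (2 + i))
      pick (inj₁ gap) = edge u v (ahead gap) uv , gap , inj₁ between
      pick (inj₂ gap) = edge v u (ahead gap) (trans (adj-sym G v u) uv) , gap , inj₂ between

  -- The partition sequence from repeated merging

  run : ∀ m → Layout G reach (suc m) → ℕ → Part n
  run m       Λ zero    = Layout.part Λ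
  -- A default: `seq` is indexed by all of `ℕ` and stays constant after the last merge.
  run zero    Λ (suc j) = Layout.part Λ
  run (suc m) Λ (suc j) = let i , i≤m , free = mergeable Λ in run m (merge-layout G reach Λ i≤m free) j

  run-finish : ∀ m Λ → Whole (run m Λ m)
  run-finish zero    Λ u v with Layout.idx Λ u | Layout.idx-< Λ u | Layout.idx Λ v | Layout.idx-< Λ v
  ... | zero | _ | zero | _ = refl
  ... | suc _ | s≤s () | _ | _
  ... | zero | _ | suc _ | s≤s ()
  run-finish (suc m) Λ = run-finish m _

  run-merges : ∀ m Λ i → suc i ≤ m → MergeOf (run m Λ i) (run m Λ (suc i))
  run-merges (suc m) Λ zero    _         =
    let i , i≤m , free = mergeable Λ in merge-layout-merges G reach Λ i≤m free
  run-merges (suc m) Λ (suc i) (s≤s i<m) = run-merges m _ i i<m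

  run-stretch : ∀ m Λ i → StretchAtMost G (run m Λ i) (reach + suc reach)
  run-stretch m       Λ zero    = Layout.stretch-bound Λ
  run-stretch zero    Λ (suc i) = Layout.stretch-bound Λ
  run-stretch (suc m) Λ (suc i) = run-stretch m _ i

Ktt-free⇒stw : ∀ {n} (G : Graph n) t (free : ¬ OverlapHasKtt G t) →
                      StwAtMost G (reach-for t + suc (reach-for t))
-- `run` starts from at least one interval, so the empty graph is treated apart.
Ktt-free⇒stw {zero} G t free = record
  { seq = λ _ () ; start = (λ ()) , (λ ()) ; finish = λ () ; merges = λ _ () } , λ _ _ ()
Ktt-free⇒stw {suc N} G t free = record
  { seq    = run G t free N Λ
  ; start  = (λ u → ≡ᵇ-refl (toℕ u)) , (λ u v eq → Fin.toℕ-injective (≡ᵇ-true⇒≡ {toℕ u} eq))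
  ; finish = run-finish G t free N Λ
  ; merges = run-merges G t free N Λ } , λ i _ → run-stretch G t free N Λ i
  where Λ = discrete-layout G (reach-for t)

theorem23 : (C : (n : ℕ) → Graph n → Set) →
    (∃[ d ] ((n : ℕ) (G : Graph n) → C n G → MaxDegreeAtMost G d)) →
    ((∃[ k ] ((n : ℕ) (G : Graph n) → C n G → StwAtMost G k))
    ⇔ (∃[ t ] ((n : ℕ) (G : Graph n) → C n G → ¬ OverlapHasKtt G t)))
theorem23 C (d , deg) = mk⇔
  -- The excluded size depends only on `d` and `k`, so one value serves the whole class.
  (λ (k , stw) → _ , λ n G c → stw⇒Ktt-free G (deg n G c) (stw n G c))
  (λ (t , free) → _ , λ n G c → Ktt-free⇒stw G t (free n G c))
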